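{- Let $a,b,n$ be non-negative integers and let $p$ be a prime. Suppose that at least one of the following holds: (i) $p$ divides none of the integers $n-a$, $n-2a+b$, $a-b$, $n$, $a^2-nb-a+b$; (ii) $p\mid n-a$, $p\nmid n-2a+b$ and $p\nmid n-1$. Then for any $(a,b)$-town$\pmod p$ family $\mathcal{F}\subseteq\mathscr{P}(n)$ we have $|\mathcal{F}|\leq n-1$.
   Context: $[n]=\{1,2,\ldots,n\}$ for a positive integer $n$, with the convention $[0]=\emptyset$, and $\mathscr{P}(n)$ is the power set of $[n]$; a family $\mathcal{F}\subseteq\mathscr{P}(n)$ is a set of (distinct) subsets of $[n]$. For integers $k\ge 2$ and $a,b$ (only their residues modulo $k$ matter), a family $\mathcal{F}\subseteq\mathscr{P}(n)$ is an $(a,b)$-town$\pmod k$ if for any distinct $A,B\in\mathcal{F}$ we have $|A|\equiv a\pmod k$ and $|A\cap B|\equiv b\pmod k$; that is, every set in $\mathcal{F}$ has cardinality $\equiv a\pmod k$ and every intersection of two distinct sets of $\mathcal{F}$ has cardinality $\equiv b\pmod k$.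
   Formalization: The statement is proved for n ≥ 1 instead of all non-negative n: at n = 0 condition (ii) can hold (e.g. p = 2, a = 0, b = 1) while the bound |F| ≤ -1 fails for every family, and condition (i) never holds there. -}

module Defs where

open import Data.Nat using (ℕ)
open import Data.Integer using (ℤ; +_; _-_)
open import Data.Integer.Divisibility using (_∣_)
open import Data.Fin.Subset using (Subset; ∣_∣; _∩_)
open import Data.List using (List; length)
open import Data.List.Membership.Propositional using (_∈_)
open import Data.List.Relation.Unary.Unique.Propositional using (Unique)
open import Relation.Binary.PropositionalEquality using (_≢_)

infix 4 _≡_[mod_]

_≡_[mod_] : ℤ → ℤ → ℕ → Set
x ≡ y [mod k ] = + k ∣ x - y

-- The ground set [n] = {1, …, n} is represented by Fin n.  A family is
-- enumerated without repetition, so its cardinality is the length of the list.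
record Family (n : ℕ) : Set where
  field
    members : List (Subset n)
    unique  : Unique members

open Family public

card : ∀ {n} → Family n → ℕ
card F = length (members F)

-- The size condition is imposed on every member, so it is not vacuous for a
-- family with a single member.
record IsTown (a b : ℤ) (k : ℕ) {n : ℕ} (F : Family n) : Set where
  field
    sizes         : ∀ {A} → A ∈ members F → + ∣ A ∣ ≡ a [mod k ]
    intersections : ∀ {A B} → A ∈ members F → B ∈ members F → A ≢ B →
                    + ∣ A ∩ B ∣ ≡ b [mod k ]

{-# OPTIONS --safe #-}

-- Modulo p, suppose there are n indicator vectors x₁, …, xₙ ∈ 𝔽ₚⁿ with Gram matrix (a − b) I + b J.
-- In case (i) the n + 1 vectors 1, x₁, …, xₙ have an invertible Gram matrix, of determinant
-- − (a − b)ⁿ⁻¹ n (a² − n b − a + b), which is impossible in dimension n.  In case (ii)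
-- the complements 1 − xᵢ have Gram matrix c (J − I) with c = n − 2 a + b, invertible since p ∤ n − 1,
-- while a ≡ n makes all of them orthogonal to 1, hence confined to a hyperplane.

module Submission where

open import Algebra.Bundles using (CommutativeRing)
open import Data.Bool using (true; false; if_then_else_; _∧_)
open import Data.Empty using (⊥)
open import Data.Fin using (Fin; zero; suc; punchIn; inject≤)
open import Data.Fin.Properties using (punchInᵢ≢i; any?; inject≤-injective)
open import Data.Fin.Subset using (Subset; ∣_∣; _∩_)
open import Data.Fin.Subset.Properties using (∩-idem)
open import Data.Integer using (ℤ; -_; 0ℤ; 1ℤ)
open import Data.Integer.Divisibility.Signed as Signed using (∣ᵤ⇒∣; ∣⇒∣ᵤ; _∣?_)
import Data.Integer.Properties as ℤ
open import Data.Integer.Tactic.RingSolver using (solve-∀)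
open import Data.List as List using (List)
open import Data.List.Membership.Propositional.Properties using (∈-lookup)
import Data.List.Relation.Unary.All as All
import Data.List.Relation.Unary.AllPairs as AllPairs
open import Data.List.Relation.Unary.Unique.Propositional using (Unique)
open import Data.Nat as ℕ using (suc)
import Data.Nat.Divisibility as ℕ
open import Data.Nat.Primality using (euclidsLemma; prime⇒nonTrivial)
import Data.Nat.Properties as ℕ
open import Data.Product using (∃; _,_)
open import Data.Sum using (inj₁; inj₂; [_,_]′)
import Data.Vec as Vec
open import Data.Vec.Functional using (Vector; _∷_; head; tail; insertAt; replicate)
open import Data.Vec.Functional.Properties using (insertAt-lookup; insertAt-punchIn)
open import Data.Vec.Properties using (lookup-zipWith)
open import Function using (_∘_)
open import Level using (0ℓ)
open import Relation.Binary.PropositionalEquality as ≡ using (_≡_; _≢_; cong; subst)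
open import Relation.Nullary using (Dec; yes; no; ¬?; contradiction)
open import Relation.Nullary.Decidable using (map′; decidable-stable)

open import Defs
open import Data.Nat using (ℕ; _≤_; _∸_)
open import Data.Nat.Primality using (Prime)
open import Data.Integer using (+_; _+_; _-_; _*_; _^_)
open import Data.Integer.Divisibility using (_∣_)
open import Data.Product using (_×_)
open import Data.Sum using (_⊎_)
open import Relation.Nullary using (¬_)

-- Indicator vectors and distinct list entries.

indicator : ∀ {n} → Subset n → Vector ℤ n
indicator A j = if Vec.lookup A j then 1ℤ else 0ℤ

lookup-distinct : ∀ {A : Set} {xs : List A} → Unique xs →
                  ∀ {i j} → i ≢ j → List.lookup xs i ≢ List.lookup xs j
lookup-distinct (x∉xs AllPairs.∷ u) {zero}  {zero}  i≢j _ = i≢j ≡.refl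
lookup-distinct (x∉xs AllPairs.∷ u) {zero}  {suc j} i≢j e = All.lookup x∉xs (∈-lookup j) e
lookup-distinct (x∉xs AllPairs.∷ u) {suc i} {zero}  i≢j e = All.lookup x∉xs (∈-lookup i) (≡.sym e)
lookup-distinct (x∉xs AllPairs.∷ u) {suc i} {suc j} i≢j e = lookup-distinct u (i≢j ∘ cong suc) e

-- The ring of integers modulo `k`.

module Modular (k : ℕ) where

  infix 4 _≈_

  -- The record wrapper lets `x` and `y` be inferred from a congruence; bare divisibility of `x - y`
  -- would not determine them.
  record _≈_ (x y : ℤ) : Set where
    constructor congruent
    field divides-difference : + k Signed.∣ x - y

  open _≈_ public

  private
    by : ∀ {x y d} → d ≡ x - y → + k Signed.∣ d → x ≈ y
    by e k∣d = congruent (subst (+ k Signed.∣_) e k∣d)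

    *-difference : ∀ x y u v → (x - y) * u + y * (u - v) ≡ x * u - y * v
    *-difference = solve-∀

    +-difference : ∀ x y u v → (x - y) + (u - v) ≡ x + u - (y + v)
    +-difference = solve-∀

    neg-difference : ∀ x y → - (x - y) ≡ - x - - y
    neg-difference = solve-∀

    telescope : ∀ x y z → (x - y) + (y - z) ≡ x - z
    telescope = solve-∀

    swap-difference : ∀ x y → - (x - y) ≡ y - x
    swap-difference = solve-∀

  ≡⇒≈ : ∀ {x y} → x ≡ y → x ≈ y
  ≡⇒≈ {x} ≡.refl = by (≡.sym (ℤ.+-inverseʳ x)) (Signed.divides 0ℤ ≡.refl)

  -- The residue ring is ℤ itself under a coarser equality, so polynomial identities can be solved
  -- over ℤ and transported by `≡⇒≈`.
  commutativeRing : CommutativeRing 0ℓ 0ℓ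
  commutativeRing = record
    { Carrier = ℤ
    ; _≈_ = _≈_
    ; _+_ = _+_
    ; _*_ = _*_
    ; -_ = -_
    ; 0# = 0ℤ
    ; 1# = 1ℤ
    ; isCommutativeRing = record
      { isRing = record
        { +-isAbelianGroup = record
          { isGroup = record
            { isMonoid = record
              { isSemigroup = record
                { isMagma = record
                  { isEquivalence = record
                    { refl = ≡⇒≈ ≡.refl
                    ; sym = λ {x} {y} (congruent d) →
                        by (swap-difference x y) (Signed.∣m⇒∣-m d)
                    ; trans = λ {x} {y} {z} (congruent d) (congruent e) →
                        by (telescope x y z) (Signed.∣m∣n⇒∣m+n d e)
                    }
                  ; ∙-cong = λ {x} {y} {u} {v} (congruent d) (congruent e) →
                      by (+-difference x y u v) (Signed.∣m∣n⇒∣m+n d e)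
                  }
                ; assoc = λ x y z → ≡⇒≈ (ℤ.+-assoc x y z)
                }
              ; identity = (λ x → ≡⇒≈ (ℤ.+-identityˡ x)) , (λ x → ≡⇒≈ (ℤ.+-identityʳ x))
              }
            ; inverse = (λ x → ≡⇒≈ (ℤ.+-inverseˡ x)) , (λ x → ≡⇒≈ (ℤ.+-inverseʳ x))
            ; ⁻¹-cong = λ {x} {y} (congruent d) →
                by (neg-difference x y) (Signed.∣m⇒∣-m d)
            }
          ; comm = λ x y → ≡⇒≈ (ℤ.+-comm x y)
          }
        ; *-cong = λ {x} {y} {u} {v} (congruent d) (congruent e) →
            by (*-difference x y u v)
               (Signed.∣m∣n⇒∣m+n (Signed.∣m⇒∣m*n u d) (Signed.∣n⇒∣m*n y e))
        ; *-assoc = λ x y z → ≡⇒≈ (ℤ.*-assoc x y z)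
        ; *-identity = (λ x → ≡⇒≈ (ℤ.*-identityˡ x)) , (λ x → ≡⇒≈ (ℤ.*-identityʳ x))
        ; distrib = (λ x y z → ≡⇒≈ (ℤ.*-distribˡ-+ x y z)) , (λ x y z → ≡⇒≈ (ℤ.*-distribʳ-+ x y z))
        }
      ; *-comm = λ x y → ≡⇒≈ (ℤ.*-comm x y)
      }
    }

  open CommutativeRing commutativeRing public
    using (setoid; semiring; refl; sym; trans; +-cong; +-congˡ; +-congʳ; *-cong; *-congˡ; *-congʳ; -‿cong)
  open import Algebra.Properties.Semiring.Sum semiring public
  open import Relation.Binary.Reasoning.Setoid setoid

  ∣⇒≈0 : ∀ {x} → + k ∣ x → x ≈ 0ℤ
  ∣⇒≈0 {x} k∣x = by (≡.sym (ℤ.+-identityʳ x)) (∣ᵤ⇒∣ k∣x)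

  ≈0⇒∣ : ∀ {x} → x ≈ 0ℤ → + k ∣ x
  ≈0⇒∣ {x} (congruent d) = ∣⇒∣ᵤ (subst (+ k Signed.∣_) (ℤ.+-identityʳ x) d)

  _≈?_ : ∀ x y → Dec (x ≈ y)
  x ≈? y = map′ congruent divides-difference (+ k ∣? x - y)

  -- Finite sums and inner products modulo `k`.

  sum-zero : ∀ {n} (f : Vector ℤ n) → (∀ i → f i ≈ 0ℤ) → sum f ≈ 0ℤ
  sum-zero {n} f f≈0 = trans (sum-cong-≋ f≈0) (sum-replicate-zero n)

  sum-const : ∀ n x → sum {n} (replicate n x) ≈ + n * x
  sum-const ℕ.zero x = refl
  sum-const (suc n) x = begin
    x + sum {n} (replicate n x) ≈⟨ +-congˡ {x} (sum-const n x) ⟩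
    x + + n * x                 ≡⟨ ℤ.suc-* (+ n) x ⟨
    + suc n * x                 ∎

  sum-affine : ∀ {n} α β (f : Vector ℤ n) → sum (λ i → α * f i + β) ≈ α * sum f + + n * β
  sum-affine {n} α β f = begin
    sum (λ i → α * f i + β)                      ≈⟨ ∑-distrib-+ (λ i → α * f i) (replicate n β) ⟩
    sum (λ i → α * f i) + sum (replicate n β)    ≈⟨ +-cong (sym (*-distribˡ-sum α f)) (sum-const n β) ⟩
    α * sum f + + n * β                          ∎

  -- Adding up all rows of a Gram system in this way leaves one equation in the total of the
  -- coefficients.
  sum-affine-zero : ∀ {n} α β (f : Vector ℤ n) → (∀ i → α * f i + β ≈ 0ℤ) → α * sum f + + n * β ≈ 0ℤ
  sum-affine-zero α β f ≈0 = trans (sym (sum-affine α β f)) (sum-zero _ ≈0)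

  dot : ∀ {n} → Vector ℤ n → Vector ℤ n → ℤ
  dot v w = sum (λ j → v j * w j)

  ones : ∀ {n} → Vector ℤ n
  ones {n} = replicate n 1ℤ

  dot-onesʳ : ∀ {n} (v : Vector ℤ n) → dot v ones ≈ sum v
  dot-onesʳ v = sum-cong-≋ (λ j → ≡⇒≈ (ℤ.*-identityʳ (v j)))

  dot-onesˡ : ∀ {n} (v : Vector ℤ n) → dot ones v ≈ sum v
  dot-onesˡ v = sum-cong-≋ (λ j → ≡⇒≈ (ℤ.*-identityˡ (v j)))

  dot-ones-ones : ∀ n → dot (ones {n}) (ones {n}) ≈ + n
  dot-ones-ones n = begin
    dot (ones {n}) (ones {n})   ≈⟨ dot-onesˡ (ones {n}) ⟩
    sum (ones {n})              ≈⟨ sum-const n 1ℤ ⟩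
    + n * 1ℤ                    ≡⟨ ℤ.*-identityʳ (+ n) ⟩
    + n                         ∎

  -- Entries may be arbitrary integers, so the entry sum, which is the product with `ones`, is
  -- recorded apart from the norm. For indicator vectors both equal the cardinality.
  record Equiangular {m n} (s a b : ℤ) (x : Vector (Vector ℤ n) m) : Set where
    field
      sums     : ∀ k → sum (x k) ≈ s
      norms    : ∀ k → dot (x k) (x k) ≈ a
      products : ∀ k l → k ≢ l → dot (x k) (x l) ≈ b

  equiangular-cong : ∀ {m n s s′ a a′ b} {x : Vector (Vector ℤ n) m} → s ≈ s′ → a ≈ a′ →
                     Equiangular s a b x → Equiangular s′ a′ b x
  equiangular-cong s≈s′ a≈a′ E = record
    { sums = λ k → trans (sums k) s≈s′
    ; norms = λ k → trans (norms k) a≈a′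
    ; products = products
    }
    where open Equiangular E

  -- Linear relations and the Gram equations they imply.

  Relation : ∀ {m n} → Vector ℤ m → Vector (Vector ℤ n) m → Set
  Relation c v = ∀ j → sum (λ i → c i * v i j) ≈ 0ℤ

  Nonzero : ∀ {m} → Vector ℤ m → Set
  Nonzero c = ∃ λ i → ¬ c i ≈ 0ℤ

  -- Interchanging the two sums turns a relation among vectors into one among inner products. With
  -- `w` running over the `v i`, this says that the Gram matrix annihilates `c`.
  relation-dot : ∀ {m n} (c : Vector ℤ m) (v : Vector (Vector ℤ n) m) → Relation c v →
                 ∀ w → sum (λ i → c i * dot (v i) w) ≈ 0ℤ
  relation-dot c v rel w = begin
    sum (λ i → c i * dot (v i) w)
      ≈⟨ sum-cong-≋ (λ i → *-distribˡ-sum (c i) (λ j → v i j * w j)) ⟩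
    sum (λ i → sum (λ j → c i * (v i j * w j)))
      ≈⟨ ∑-comm (λ i j → c i * (v i j * w j)) ⟩
    sum (λ j → sum (λ i → c i * (v i j * w j)))
      ≈⟨ sum-cong-≋ (λ j → sum-cong-≋ (λ i → ≡⇒≈ (≡.sym (ℤ.*-assoc (c i) (v i j) (w j))))) ⟩
    sum (λ j → sum (λ i → c i * v i j * w j))
      ≈⟨ sum-cong-≋ (λ j → *-distribʳ-sum (w j) (λ i → c i * v i j)) ⟨
    sum (λ j → sum (λ i → c i * v i j) * w j)
      ≈⟨ sum-zero _ (λ j → *-congʳ {w j} (rel j)) ⟩
    0ℤ ∎

  -- This is row `l` of `(a - b) I + b J` applied to `c`: the term at `l` is split off, and
  -- `b * c l` is added and subtracted to complete the total `sum c`.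
  weighted-sum : ∀ {n a b} (c g : Vector ℤ n) l → g l ≈ a → (∀ i → i ≢ l → g i ≈ b) →
                 sum (λ i → c i * g i) ≈ (a - b) * c l + b * sum c
  weighted-sum {suc n} {a} {b} c g l gl≈a g≈b = begin
    sum (λ i → c i * g i)
      ≈⟨ sum-remove {i = l} (λ i → c i * g i) ⟩
    c l * g l + sum (λ i → c′ i * g (punchIn l i))
      ≈⟨ +-cong (*-congˡ {c l} gl≈a)
           (sum-cong-≋ (λ i → *-congˡ {c′ i} (g≈b (punchIn l i) (punchInᵢ≢i l i)))) ⟩
    c l * a + sum (λ i → c′ i * b)
      ≈⟨ +-congˡ {c l * a} (sym (*-distribʳ-sum b c′)) ⟩
    c l * a + sum c′ * b
      ≡⟨ rearrangement a b (c l) (sum c′) ⟩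
    (a - b) * c l + b * (c l + sum c′)
      ≈⟨ +-congˡ {(a - b) * c l} (*-congˡ {b} (sym (sum-remove {i = l} c))) ⟩
    (a - b) * c l + b * sum c ∎
    where
    c′ : Vector ℤ n
    c′ i = c (punchIn l i)

    rearrangement : ∀ a b x s → x * a + s * b ≡ (a - b) * x + b * (x + s)
    rearrangement = solve-∀

  -- On the hyperplane of zero entry sum the first coordinate is minus the sum of the others, so a
  -- relation in the remaining coordinates forces it in the first.
  relation-tail : ∀ {m n} (c : Vector ℤ m) (v : Vector (Vector ℤ (suc n)) m) →
                  (∀ i → sum (v i) ≈ 0ℤ) → Relation c (λ i → tail (v i)) → Relation c v
  relation-tail c v sum≈0 rel (suc j) = rel j
  relation-tail c v sum≈0 rel zero = begin
    sum (λ i → c i * head (v i))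
      ≡⟨ ℤ.+-identityʳ _ ⟨
    sum (λ i → c i * head (v i)) + 0ℤ
      -- The zero comes from pairing the truncated relation with `ones`; it completes each head to
      -- the full entry sum.
      ≈⟨ +-congˡ {sum (λ i → c i * head (v i))} (sym (relation-dot c (λ i → tail (v i)) rel ones)) ⟩
    sum (λ i → c i * head (v i)) + sum (λ i → c i * dot (tail (v i)) ones)
      ≈⟨ ∑-distrib-+ (λ i → c i * head (v i)) (λ i → c i * dot (tail (v i)) ones) ⟨
    sum (λ i → c i * head (v i) + c i * dot (tail (v i)) ones)
      ≈⟨ sum-zero _ each ⟩
    0ℤ ∎
    where
    each : ∀ i → c i * head (v i) + c i * dot (tail (v i)) ones ≈ 0ℤ
    each i = begin
      c i * head (v i) + c i * dot (tail (v i)) ones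
        ≡⟨ ℤ.*-distribˡ-+ (c i) (head (v i)) _ ⟨
      c i * (head (v i) + dot (tail (v i)) ones)
        ≈⟨ *-congˡ {c i} (+-congˡ {head (v i)} (dot-onesʳ (tail (v i)))) ⟩
      c i * sum (v i)
        ≈⟨ *-congˡ {c i} (sum≈0 i) ⟩
      c i * 0ℤ
        ≡⟨ ℤ.*-zeroʳ (c i) ⟩
      0ℤ ∎

  -- From towns to equiangular vectors.

  sum-indicator : ∀ {n} (A : Subset n) → sum (indicator A) ≡ + ∣ A ∣
  sum-indicator Vec.[] = ≡.refl
  sum-indicator (true Vec.∷ A) = cong (_+_ 1ℤ) (sum-indicator A)
  sum-indicator (false Vec.∷ A) = ≡.trans (ℤ.+-identityˡ _) (sum-indicator A)

  dot-indicator : ∀ {n} (A B : Subset n) → dot (indicator A) (indicator B) ≡ + ∣ A ∩ B ∣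
  dot-indicator A B = ≡.trans (sum-cong-≗ pointwise) (sum-indicator (A ∩ B))
    where
    if-∧ : ∀ x y → (if x then 1ℤ else 0ℤ) * (if y then 1ℤ else 0ℤ) ≡ (if x ∧ y then 1ℤ else 0ℤ)
    if-∧ true  true  = ≡.refl
    if-∧ true  false = ≡.refl
    if-∧ false y     = ≡.refl

    pointwise : ∀ j → indicator A j * indicator B j ≡ indicator (A ∩ B) j
    pointwise j = ≡.trans (if-∧ (Vec.lookup A j) (Vec.lookup B j))
      (cong (if_then 1ℤ else 0ℤ) (≡.sym (lookup-zipWith _∧_ j A B)))

  -- The vectors are the indicators of the first `m` members. Injectivity of `inject≤` and `unique`
  -- make distinct indices select distinct sets, as the intersection condition requires.
  town-equiangular : ∀ {m n a b} (F : Family n) → IsTown a b k F → m ≤ card F →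
                     ∃ λ (x : Vector (Vector ℤ n) m) → Equiangular a a b x
  town-equiangular {m} {n} {a} {b} F town m≤|F| = (λ i → indicator (set i)) , record
    { sums = λ i → trans (≡⇒≈ (sum-indicator (set i))) (size i)
    ; norms = λ i → trans
        (≡⇒≈ (≡.trans (dot-indicator (set i) (set i)) (cong (λ A → + ∣ A ∣) (∩-idem (set i))))) (size i)
    ; products = λ i j i≢j → trans (≡⇒≈ (dot-indicator (set i) (set j)))
        (congruent (∣ᵤ⇒∣ (intersections (∈-lookup _) (∈-lookup _)
          (lookup-distinct (unique F) (i≢j ∘ inject≤-injective m≤|F| m≤|F| i j)))))
    }
    where
    open IsTown town

    set : Fin m → Subset n
    set i = List.lookup (members F) (inject≤ i m≤|F|)

    size : ∀ i → + ∣ set i ∣ ≈ a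
    size i = congruent (∣ᵤ⇒∣ (sizes (∈-lookup _)))

-- Linear dependence modulo a prime.

module ModularPrime {p : ℕ} (p-prime : Prime p) where

  open Modular p public
  open import Relation.Binary.Reasoning.Setoid setoid

  noZeroDivisors : ∀ x y → x * y ≈ 0ℤ → x ≈ 0ℤ ⊎ y ≈ 0ℤ
  noZeroDivisors x y xy≈0 =
    [ inj₁ ∘ ∣⇒≈0 , inj₂ ∘ ∣⇒≈0 ]′
      (euclidsLemma _ _ p-prime (subst (p ℕ.∣_) (ℤ.abs-* x y) (≈0⇒∣ xy≈0)))

  -- Cancellation takes the place of division: no inverse modulo `p` is ever constructed.
  cancelˡ : ∀ x y → ¬ x ≈ 0ℤ → x * y ≈ 0ℤ → y ≈ 0ℤ
  cancelˡ x y x≉0 xy≈0 with noZeroDivisors x y xy≈0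
  ... | inj₁ x≈0 = contradiction x≈0 x≉0
  ... | inj₂ y≈0 = y≈0

  1≉0 : ¬ 1ℤ ≈ 0ℤ
  1≉0 1≈0 = ℕ.nonTrivial⇒≢1 {{prime⇒nonTrivial p-prime}} (ℕ.∣1⇒≡1 (≈0⇒∣ 1≈0))

  -- Fraction-free elimination: the entries are the two-by-two minors through the pivot `v l zero`.
  -- Column zero, where these minors vanish, is dropped.
  cleared : ∀ {m n} → Vector (Vector ℤ (suc n)) (suc m) → Fin (suc m) → Vector (Vector ℤ n) m
  cleared v l i j = v l zero * v (punchIn l i) (suc j) - v (punchIn l i) zero * v l (suc j)

  -- Gaussian elimination: the relation d between the rows cleared by the pivot row l
  -- pulls back to one between the rows of v.
  pivot : ∀ {m n} (v : Vector (Vector ℤ (suc n)) (suc m)) l → ¬ v l zero ≈ 0ℤ → ∀ d → Nonzero d →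
          Relation d (cleared v l) →
          ∃ λ c → Nonzero c × Relation c v
  pivot {m} v l α≉0 d (i , di≉0) rel = c , (punchIn l i , ci≉0) , relation
    where
    α = v l zero

    v′ : Vector (Vector ℤ _) m
    v′ i = v (punchIn l i)

    -- Expanding the cleared rows weighted by `d` gives row `punchIn l i` the coefficient `d i * α`
    -- and collects `s` on the pivot row.
    s = sum (λ i → d i * - v′ i zero)

    c = insertAt (λ i → d i * α) l s

    ci≉0 : ¬ c (punchIn l i) ≈ 0ℤ
    ci≉0 ci≈0 = di≉0 (cancelˡ α (d i) α≉0
      (trans (≡⇒≈ (≡.trans (ℤ.*-comm α (d i)) (≡.sym (insertAt-punchIn (λ i → d i * α) l s i)))) ci≈0))

    combine : ∀ d α x y z → d * - x * y + d * α * z ≡ d * (α * z - x * y)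
    combine = solve-∀

    -- In column zero the minors have a repeated column and vanish identically; `rel` covers the
    -- other columns.
    column≈0 : ∀ j → sum (λ i → d i * (α * v′ i j - v′ i zero * v l j)) ≈ 0ℤ
    column≈0 zero    = sum-zero _ (λ i → ≡⇒≈ (vanish (d i) α (v′ i zero)))
      where
      vanish : ∀ d x y → d * (x * y - y * x) ≡ 0ℤ
      vanish = solve-∀
    column≈0 (suc j) = rel j

    relation : Relation c v
    relation j = begin
      sum (λ i → c i * v i j)
        ≈⟨ sum-remove {i = l} (λ i → c i * v i j) ⟩
      c l * v l j + sum (λ i → c (punchIn l i) * v′ i j)
        ≈⟨ +-cong (*-congʳ {v l j} (≡⇒≈ (insertAt-lookup (λ i → d i * α) l s)))
             (sum-cong-≋ (λ i → *-congʳ {v′ i j} (≡⇒≈ (insertAt-punchIn (λ i → d i * α) l s i)))) ⟩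
      s * v l j + sum (λ i → d i * α * v′ i j)
        ≈⟨ +-congʳ {sum (λ i → d i * α * v′ i j)} (*-distribʳ-sum (v l j) (λ i → d i * - v′ i zero)) ⟩
      sum (λ i → d i * - v′ i zero * v l j) + sum (λ i → d i * α * v′ i j)
        ≈⟨ ∑-distrib-+ (λ i → d i * - v′ i zero * v l j) (λ i → d i * α * v′ i j) ⟨
      sum (λ i → d i * - v′ i zero * v l j + d i * α * v′ i j)
        ≈⟨ sum-cong-≋ (λ i → ≡⇒≈ (combine (d i) α (v′ i zero) (v l j) (v′ i j))) ⟩
      sum (λ i → d i * (α * v′ i j - v′ i zero * v l j))
        ≈⟨ column≈0 j ⟩
      0ℤ ∎

  -- Induction on the dimension, eliminating column zero whenever it contains an entry nonzero
  -- modulo `p`.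
  dependent : ∀ n (v : Vector (Vector ℤ n) (suc n)) → ∃ λ c → Nonzero c × Relation c v
  dependent ℕ.zero v = ones , (zero , 1≉0) , λ ()
  dependent (suc n) v with any? (λ i → ¬? (v i zero ≈? 0ℤ))
  ... | yes (l , α≉0) =
    let d , d≉0 , rel = dependent n (cleared v l) in pivot v l α≉0 d d≉0 rel
  -- Column zero vanishes modulo `p`, so deleting it loses nothing. The first vector gets
  -- coefficient zero, which leaves one vector more than the new dimension.
  ... | no noPivot =
    let d , (i , di≉0) , rel = dependent n (λ i j → v (suc i) (suc j)) in
    0ℤ ∷ d , (suc i , di≉0) , relation d rel
    where
    column≈0 : ∀ i → v i zero ≈ 0ℤ
    column≈0 i = decidable-stable (v i zero ≈? 0ℤ) (λ ≉0 → noPivot (i , ≉0))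

    relation : ∀ d → Relation d (λ i j → v (suc i) (suc j)) → Relation (0ℤ ∷ d) v
    relation d rel zero = sum-zero _ λ i →
      trans (*-congˡ {(0ℤ ∷ d) i} (column≈0 i)) (≡⇒≈ (ℤ.*-zeroʳ ((0ℤ ∷ d) i)))
    relation d rel (suc j) = trans (≡⇒≈ (ℤ.+-identityˡ _)) (rel j)

  -- Nonsingular Gram systems.

  -- The bordered Gram system is solved directly, without its determinant. The three nonvanishing
  -- factors are cancelled in turn: the quadratic one gives `S ≈ 0ℤ`, then `+ n` gives `c₀ ≈ 0ℤ`,
  -- then `a - b` gives the remaining coefficients.
  independent-with-ones : ∀ {n a b} {x : Vector (Vector ℤ n) n} → Equiangular a a b x →
    ¬ a - b ≈ 0ℤ → ¬ + n ≈ 0ℤ → ¬ a ^ 2 - + n * b - a + b ≈ 0ℤ →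
    ∀ c → Relation c (ones ∷ x) → ∀ i → c i ≈ 0ℤ
  independent-with-ones {n} {a} {b} {x} E a-b≉0 n≉0 δ≉0 c rel = vanishes
    where
    open Equiangular E

    c₀ = head c
    c′ = tail c
    S = sum c′

    -- The part independent of `l` is grouped as a constant so that `sum-affine-zero` can add up the
    -- rows.
    row : ∀ l → (a - b) * c′ l + (c₀ * a + b * S) ≈ 0ℤ
    row l = begin
      (a - b) * c′ l + (c₀ * a + b * S)
        ≡⟨ rearrangement ((a - b) * c′ l) (c₀ * a) (b * S) ⟩
      c₀ * a + ((a - b) * c′ l + b * S)
        ≈⟨ +-cong (*-congˡ {c₀} (trans (dot-onesˡ (x l)) (sums l)))
             (weighted-sum c′ (λ i → dot (x i) (x l)) l (norms l) (λ i → products i l)) ⟨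
      c₀ * dot ones (x l) + sum (λ i → c′ i * dot (x i) (x l))
        ≈⟨ relation-dot c (ones ∷ x) rel (x l) ⟩
      0ℤ ∎
      where
      rearrangement : ∀ x y z → x + (y + z) ≡ y + (x + z)
      rearrangement = solve-∀

    ones-row : c₀ * + n + S * a ≈ 0ℤ
    ones-row = begin
      c₀ * + n + S * a
        ≈⟨ +-cong (*-congˡ {c₀} (sym (dot-ones-ones n)))
             (*-distribʳ-sum a c′) ⟩
      c₀ * dot {n} ones ones + sum (λ i → c′ i * a)
        ≈⟨ +-congˡ {c₀ * dot {n} ones ones}
             (sum-cong-≋ (λ i → *-congˡ {c′ i} (sym (trans (dot-onesʳ (x i)) (sums i))))) ⟩
      c₀ * dot {n} ones ones + sum (λ i → c′ i * dot (x i) ones)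
        ≈⟨ relation-dot c (ones ∷ x) rel (ones {n}) ⟩
      0ℤ ∎

    S≈0 : S ≈ 0ℤ
    -- Taking `a` times `ones-row` minus the sum of all rows cancels `c₀`.
    S≈0 = cancelˡ (a ^ 2 - + n * b - a + b) S δ≉0 (begin
      (a ^ 2 - + n * b - a + b) * S
        ≡⟨ eliminate-c₀ a b (+ n) c₀ S ⟩
      a * (c₀ * + n + S * a) - ((a - b) * S + + n * (c₀ * a + b * S))
        ≈⟨ +-cong (*-congˡ {a} ones-row) (-‿cong (sum-affine-zero (a - b) (c₀ * a + b * S) c′ row)) ⟩
      a * 0ℤ - 0ℤ
        ≡⟨ zeros a ⟩
      0ℤ ∎)
      where
      -- the exponent is unfolded because solve-∀ does not recognise ℤ's _^_
      eliminate-c₀ : ∀ a b n c₀ S → (a * (a * 1ℤ) - n * b - a + b) * S ≡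
                     a * (c₀ * n + S * a) - ((a - b) * S + n * (c₀ * a + b * S))
      eliminate-c₀ = solve-∀

      zeros : ∀ a → a * 0ℤ - 0ℤ ≡ 0ℤ
      zeros = solve-∀

    c₀≈0 : c₀ ≈ 0ℤ
    c₀≈0 = cancelˡ (+ n) c₀ n≉0 (begin
      + n * c₀                ≡⟨ rearrangement (+ n) c₀ a ⟩
      c₀ * + n + 0ℤ * a       ≈⟨ +-congˡ {c₀ * + n} (*-congʳ {a} (sym S≈0)) ⟩
      c₀ * + n + S * a        ≈⟨ ones-row ⟩
      0ℤ                      ∎)
      where
      rearrangement : ∀ n c a → n * c ≡ c * n + 0ℤ * a
      rearrangement = solve-∀

    β≈0 : c₀ * a + b * S ≈ 0ℤ
    β≈0 = begin
      c₀ * a + b * S    ≈⟨ +-cong (*-congʳ {a} c₀≈0) (*-congˡ {b} S≈0) ⟩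
      0ℤ * a + b * 0ℤ   ≡⟨ zeros a b ⟩
      0ℤ                ∎
      where
      zeros : ∀ a b → 0ℤ * a + b * 0ℤ ≡ 0ℤ
      zeros = solve-∀

    vanishes : ∀ i → c i ≈ 0ℤ
    vanishes zero    = c₀≈0
    vanishes (suc l) = cancelˡ (a - b) (c′ l) a-b≉0 (begin
      (a - b) * c′ l                       ≡⟨ ℤ.+-identityʳ _ ⟨
      (a - b) * c′ l + 0ℤ                  ≈⟨ +-congˡ {(a - b) * c′ l} (sym β≈0) ⟩
      (a - b) * c′ l + (c₀ * a + b * S)    ≈⟨ row l ⟩
      0ℤ                                   ∎)

  -- The Gram matrix is `b (J - I)`, so every row reads `b * c l ≈ b * S`. Summing the rows gives
  -- `(n - 1) * (b * S) ≈ 0`, hence `b * S ≈ 0` and each `b * c l ≈ 0`.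
  isotropic-independent : ∀ {n b} {x : Vector (Vector ℤ n) n} → Equiangular 0ℤ 0ℤ b x →
    ¬ b ≈ 0ℤ → ¬ + n - 1ℤ ≈ 0ℤ → ∀ c → Relation c x → ∀ i → c i ≈ 0ℤ
  isotropic-independent {n} {b} {x} E b≉0 n-1≉0 c rel l = cancelˡ b (c l) b≉0 (begin
    b * c l                                   ≡⟨ rearrangement b (c l) S ⟩
    b * S - ((0ℤ - b) * c l + b * S)          ≈⟨ +-cong bS≈0 (-‿cong (row l)) ⟩
    0ℤ - 0ℤ                                   ∎)
    where
    open Equiangular E

    S = sum c

    rearrangement : ∀ b x s → b * x ≡ b * s - ((0ℤ - b) * x + b * s)
    rearrangement = solve-∀

    row : ∀ l → (0ℤ - b) * c l + b * S ≈ 0ℤ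
    row l = trans
      (sym (weighted-sum c (λ i → dot (x i) (x l)) l (norms l) (λ i → products i l)))
      (relation-dot c x rel (x l))

    bS≈0 : b * S ≈ 0ℤ
    bS≈0 = cancelˡ (+ n - 1ℤ) (b * S) n-1≉0
      (trans (≡⇒≈ (factor b (+ n) S)) (sum-affine-zero (0ℤ - b) (b * S) c row))
      where
      factor : ∀ b n s → (n - 1ℤ) * (b * s) ≡ (0ℤ - b) * s + n * (b * s)
      factor = solve-∀

  -- Complementary vectors.

  -- The affine form `- 1ℤ * v j + 1ℤ` lets `sum-affine` apply directly.
  complement : ∀ {n} → Vector ℤ n → Vector ℤ n
  complement v j = - 1ℤ * v j + 1ℤ

  sum-complement : ∀ {n} (v : Vector ℤ n) → sum (complement v) ≈ + n - sum v
  sum-complement {n} v = trans (sum-affine (- 1ℤ) 1ℤ v) (≡⇒≈ (rearrangement (+ n) (sum v)))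
    where
    rearrangement : ∀ n s → - 1ℤ * s + n * 1ℤ ≡ n - s
    rearrangement = solve-∀

  -- Pointwise, `(1 - x)(1 - y)` is `1 - (x + y)` plus `x y`, so `sum-complement` applies to
  -- `v + w`, whose entries need not be 0 or 1.
  dot-complement : ∀ {n} (v w : Vector ℤ n) →
    dot (complement v) (complement w) ≈ + n - (sum v + sum w) + dot v w
  dot-complement {n} v w = begin
    dot (complement v) (complement w)
      ≈⟨ sum-cong-≋ (λ j → ≡⇒≈ (expand (v j) (w j))) ⟩
    sum (λ j → complement (λ j → v j + w j) j + v j * w j)
      ≈⟨ ∑-distrib-+ (complement (λ j → v j + w j)) (λ j → v j * w j) ⟩
    sum (complement (λ j → v j + w j)) + dot v w
      ≈⟨ +-congʳ {dot v w} (sum-complement (λ j → v j + w j)) ⟩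
    + n - sum (λ j → v j + w j) + dot v w
      ≈⟨ +-congʳ {dot v w} (+-congˡ {+ n} (-‿cong (∑-distrib-+ v w))) ⟩
    + n - (sum v + sum w) + dot v w ∎
    where
    expand : ∀ x y → (- 1ℤ * x + 1ℤ) * (- 1ℤ * y + 1ℤ) ≡ - 1ℤ * (x + y) + 1ℤ + x * y
    expand = solve-∀

  -- Sums and norms of the complements share the value `n - a`. When `p` divides it, the complements
  -- are isotropic and orthogonal to `ones`.
  complement-equiangular : ∀ {m n a b} {x : Vector (Vector ℤ n) m} → Equiangular a a b x →
    Equiangular (+ n - a) (+ n - a) (+ n - + 2 * a + b) (λ i → complement (x i))
  complement-equiangular {n = n} {a} {b} {x} E = record
    { sums = λ k → trans (sum-complement (x k)) (+-congˡ {+ n} (-‿cong (sums k)))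
    ; norms = λ k → trans (gram k k (norms k)) (≡⇒≈ (norm (+ n) a))
    ; products = λ k l k≢l → trans (gram k l (products k l k≢l)) (≡⇒≈ (product (+ n) a b))
    }
    where
    open Equiangular E

    gram : ∀ k l {e} → dot (x k) (x l) ≈ e →
           dot (complement (x k)) (complement (x l)) ≈ + n - (a + a) + e
    gram k l ≈e = trans (dot-complement (x k) (x l))
      (+-cong (+-congˡ {+ n} (-‿cong (+-cong (sums k) (sums l)))) ≈e)

    norm : ∀ n a → n - (a + a) + a ≡ n - a
    norm = solve-∀

    product : ∀ n a b → n - (a + a) + b ≡ n - + 2 * a + b
    product = solve-∀

  -- Dimension contradictions and the bound.

  -- Adjoining `ones` makes `n + 1` vectors in dimension `n`; their forced dependence contradicts
  -- `independent-with-ones`.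
  no-equiangular-basis : ∀ {n a b} {x : Vector (Vector ℤ n) n} → Equiangular a a b x →
    ¬ a - b ≈ 0ℤ → ¬ + n ≈ 0ℤ → ¬ a ^ 2 - + n * b - a + b ≈ 0ℤ → ⊥
  no-equiangular-basis {n} {x = x} E a-b≉0 n≉0 δ≉0 =
    let c , (i , ci≉0) , rel = dependent n (ones ∷ x) in
    ci≉0 (independent-with-ones E a-b≉0 n≉0 δ≉0 c rel i)

  -- Zero sums permit deleting one coordinate, which leaves `suc n` vectors in dimension `n`. Their
  -- relation lifts back through `relation-tail`.
  no-isotropic-basis : ∀ {n b} {x : Vector (Vector ℤ (suc n)) (suc n)} → Equiangular 0ℤ 0ℤ b x →
    ¬ b ≈ 0ℤ → ¬ + suc n - 1ℤ ≈ 0ℤ → ⊥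
  no-isotropic-basis {n} {x = x} E b≉0 n-1≉0 =
    let c , (i , ci≉0) , rel = dependent n (λ i → tail (x i)) in
    ci≉0 (isotropic-independent E b≉0 n-1≉0 c (relation-tail c x (Equiangular.sums E) rel) i)

proposition2p5 : (a b n p : ℕ) → Prime p → 1 ≤ n →
    ( ( ¬ (+ p ∣ + n - + a)
    × ¬ (+ p ∣ + n - + 2 * + a + + b)
    × ¬ (+ p ∣ + a - + b)
    × ¬ (+ p ∣ + n)
    × ¬ (+ p ∣ (+ a) ^ 2 - + n * + b - + a + + b) )
    ⊎ ( + p ∣ + n - + a
    × ¬ (+ p ∣ + n - + 2 * + a + + b)
    × ¬ (+ p ∣ + n - + 1) ) ) →
    (F : Family n) → IsTown (+ a) (+ b) p F → card F ≤ n ∸ 1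
proposition2p5 a b (suc n) p p-prime 1≤n hypothesis F town =
  -- Since `1 ≤ n`, the dimension is written `suc n` and the bound becomes the new `n`. It suffices
  -- to refute having `suc n` members, as many as the dimension.
  ℕ.≤-pred (ℕ.≰⇒> λ n≤|F| → impossible hypothesis (town-equiangular F town n≤|F|))
  where
  open ModularPrime p-prime

  impossible : _ → ∃ (Equiangular (+ a) (+ a) (+ b)) → ⊥
  impossible (inj₁ (_ , _ , p∤a-b , p∤n , p∤δ)) (x , E) =
    no-equiangular-basis E (p∤a-b ∘ ≈0⇒∣) (p∤n ∘ ≈0⇒∣) (p∤δ ∘ ≈0⇒∣)
  impossible (inj₂ (p∣n-a , p∤c , p∤n-1)) (x , E) =
    no-isotropic-basis
      (equiangular-cong (∣⇒≈0 p∣n-a) (∣⇒≈0 p∣n-a) (complement-equiangular E))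
      (p∤c ∘ ≈0⇒∣) (p∤n-1 ∘ ≈0⇒∣)
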